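{- For every integer $k\ge 0$, $|I_k(132,213)|$ is the number of Gorenstein partitions of $k$.
   Context: A permutation of length $n$ is a word $\pi=\pi_1\cdots\pi_n$ containing each of $1,\dots,n$ exactly once. The sum of permutations $\rho=\rho_1\cdots\rho_n$ and $\tau=\tau_1\cdots\tau_m$ is the permutation $\rho\oplus\tau=\rho_1\cdots\rho_n(n+\tau_1)\cdots(n+\tau_m)$ of length $n+m$. A permutation is decomposable if it equals $\rho\oplus\tau$ for some non-empty permutations $\rho,\tau$; a non-empty permutation that is not decomposable is indecomposable. An inversion of $\pi$ is a pair $(i,j)$ with $i<j$ and $\pi_i>\pi_j$. A permutation $\pi$ contains a permutation (pattern) $\tau=\tau_1\cdots\tau_m$ if there are indices $i_1<\dots<i_m$ such that $\pi_{i_1},\dots,\pi_{i_m}$ is order-isomorphic to $\tau_1,\dots,\tau_m$; otherwise $\pi$ avoids $\tau$. $I_k(\tau_1,\dots,\tau_r)$ denotes the (finite) set of all indecomposable permutations, of any length, with exactly $k$ inversions that avoid all of $\tau_1,\dots,\tau_r$. A partition $\rho=(\rho_1\ge\dots\ge\rho_r\ge 1)$ is regarded as the order ideal $\{(a,i): 1\le i\le r,\ 1\le a\le\rho_i\}$ of $\{1,2,\dots\}\times\{1,2,\dots\}$ under the product order. The partition is Gorenstein if all maximal chains (with respect to inclusion) of this finite poset have the same size. The empty partition of $0$ is Gorenstein. -}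

module Defs where

open import Data.Fin as Fin using (Fin; toℕ)
import Data.Fin.Properties as Fin
open import Data.List using (List; []; _++_; length; map; lookup; filter; allFin; applyUpTo; cartesianProduct)
open import Data.List.Membership.Propositional using (_∈_)
open import Data.List.Relation.Binary.Permutation.Propositional using (_↭_)
open import Data.List.Relation.Binary.Subset.Propositional using (_⊆_)
open import Data.List.Relation.Unary.All using (All)
open import Data.List.Relation.Unary.AllPairs using (AllPairs)
open import Data.List.Relation.Unary.Linked using (Linked)
open import Data.List.Relation.Unary.Unique.Propositional using (Unique)
open import Data.Nat using (ℕ; suc; _+_; _≤_; _≥_; _<_; _<?_)
open import Data.Nat.ListAction using (sum)
open import Data.Product using (Σ-syntax; ∃-syntax; ∃₂; _×_; _,_)
open import Data.Product.Relation.Binary.Pointwise.NonDependent using (Pointwise)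
open import Data.Sum using (_⊎_)
open import Function.Bundles using (_⇔_)
open import Relation.Binary using (Rel)
open import Relation.Binary.PropositionalEquality using (_≡_; _≢_)
open import Relation.Nullary using (¬_)
open import Relation.Nullary.Decidable using (_×-dec_)
open import Relation.Unary using (Pred)
open import Level using (0ℓ)

HasCardinality : {A : Set} → Pred A 0ℓ → ℕ → Set
HasCardinality P n = ∃[ xs ] Unique xs × (∀ x → x ∈ xs ⇔ P x) × length xs ≡ n

Word : Set
Word = List ℕ

-- The letters are 1, …, n, where n is the length of the word.
IsPermutation : Pred Word 0ℓ
IsPermutation π = π ↭ applyUpTo suc (length π)

infixr 5 _⊕_

_⊕_ : Word → Word → Word
ρ ⊕ τ = ρ ++ map (length ρ +_) τ

Decomposable : Pred Word 0ℓ
Decomposable π = ∃₂ λ ρ τ →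
  IsPermutation ρ × IsPermutation τ × ρ ≢ [] × τ ≢ [] × π ≡ ρ ⊕ τ

Indecomposable : Pred Word 0ℓ
Indecomposable π = π ≢ [] × ¬ Decomposable π

inversions : (π : Word) → List (Fin (length π) × Fin (length π))
inversions π =
  filter (λ (i , j) → (i Fin.<? j) ×-dec (lookup π j <? lookup π i))
         (cartesianProduct (allFin (length π)) (allFin (length π)))

Contains : Word → Word → Set
Contains π τ = Σ[ ι ∈ (Fin (length τ) → Fin (length π)) ]
    (∀ a b → a Fin.< b → ι a Fin.< ι b)
  × (∀ a b → lookup π (ι a) < lookup π (ι b) ⇔ lookup τ a < lookup τ b)

Avoids : Word → Word → Set
Avoids π τ = ¬ Contains π τ

I : ℕ → List Word → Pred Word 0ℓ
I k τs π =
  IsPermutation π × Indecomposable π × length (inversions π) ≡ k × All (Avoids π) τs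

IsPartitionOf : ℕ → Pred (List ℕ) 0ℓ
IsPartitionOf k ρ = Linked _≥_ ρ × All (1 ≤_) ρ × sum ρ ≡ k

-- Rows are numbered from 1, whereas Fin counts from 0.
Ideal : List ℕ → Pred (ℕ × ℕ) 0ℓ
Ideal ρ (a , i) = ∃[ j ] i ≡ suc (toℕ j) × 1 ≤ a × a ≤ lookup ρ j

_≼_ : Rel (ℕ × ℕ) 0ℓ
_≼_ = Pointwise _≤_ _≤_

-- A finite set of cells is represented by a repetition-free list, in any order,
-- so that its size is the length of the list.
IsChain : Pred (ℕ × ℕ) 0ℓ → Pred (List (ℕ × ℕ)) 0ℓ
IsChain P C = Unique C × All P C × AllPairs (λ x y → x ≼ y ⊎ y ≼ x) C

IsMaximalChain : Pred (ℕ × ℕ) 0ℓ → Pred (List (ℕ × ℕ)) 0ℓ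
IsMaximalChain P C = IsChain P C × (∀ D → IsChain P D → C ⊆ D → D ⊆ C)

Gorenstein : Pred (List ℕ) 0ℓ
Gorenstein ρ =
  ∀ C D → IsMaximalChain (Ideal ρ) C → IsMaximalChain (Ideal ρ) D → length C ≡ length D

GorensteinPartition : ℕ → Pred (List ℕ) 0ℓ
GorensteinPartition k ρ = IsPartitionOf k ρ × Gorenstein ρ

{-# OPTIONS --safe #-}
module Submission where

-- Both families are in bijection with the compositions m₁, …, mᵣ, where r ≥ 2 or the
-- composition is (1), whose second elementary symmetric function, the sum of mᵢ mⱼ
-- over i < j, equals k. There are finitely many of these, because k is at least
-- m₁ + ⋯ + mᵣ - 1.
--
-- In a permutation avoiding 132 and 213, let p be the first letter. The larger letters
-- increase, by avoidance of 132, and precede the smaller ones, by avoidance of 213.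
-- So the permutation starts with p, p + 1, …, n and continues with a permutation of
-- 1, …, p - 1 of the same kind (leading-run, Allowed⇒skew). Hence these permutations
-- are the skew sums of increasing runs, one run of length mᵢ for each part of a
-- composition. Two letters are inverted exactly when they lie in different runs, so
-- the number of inversions is the symmetric function (inv-skew). A skew sum of two or
-- more runs is indecomposable, because its first letter exceeds its last, and a single
-- run is indecomposable only if it has length 1.
--
-- On the side of partitions, let the rank of a cell be the sum of its coordinates. A
-- maximal chain of the ideal runs from the cell (1 , 1) to an outer corner and meets
-- every antidiagonal in between (maximal-chain-rank, path-maximal). Therefore the
-- partition is Gorenstein exactly when all its outer corners have the same rank
-- (pure⇒Gorenstein, Gorenstein⇒Aligned). For a non-empty partition, in terms of the
-- multiplicities m₁, …, mᵣ₋₁ of the distinct row lengths, in decreasing order of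
-- length, and of the smallest row length mᵣ, this says that the j-th distinct length
-- is mⱼ₊₁ + ⋯ + mᵣ (pure-shape, aligned⇒shape). The size of such a partition is again
-- the sum of mᵢ mⱼ over i < j (sum-shape).

open import Data.Fin as Fin using (Fin; zero; suc)
open import Data.Fin.Patterns using (0F; 1F; 2F)
import Data.Fin.Properties as Fin
open import Data.List using (List; []; _∷_; _++_; length; map; lookup; filter; allFin; tabulate; applyUpTo; upTo; cartesianProduct; cartesianProductWith; deduplicate; replicate)
open import Data.List.Membership.Propositional using (_∈_; find; lose)
open import Data.List.Membership.Propositional.Properties using (∈-map⁺; ∈-map⁻; ∈-filter⁺; ∈-filter⁻; ∈-deduplicate⁺; ∈-deduplicate⁻; ∈-cartesianProductWith⁺; ∈-upTo⁺; ∈-++⁺ˡ; ∈-++⁺ʳ; ∈-++⁻; ∈-∃++; ∈-lookup)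
open import Data.List.Properties using (≡-dec; ∷-injective; ∷-injectiveʳ; ++-identityʳ; ++-cancelˡ; length-++; length-map; length-++-sucʳ; map-tabulate; tabulate-cong; tabulate-lookup; filter-++; filter-all; filter-none; filter-≐)
open import Data.List.Relation.Binary.Permutation.Propositional using (_↭_; ↭-refl; ↭-sym; ↭-trans; ↭-reflexive)
open import Data.List.Relation.Binary.Permutation.Propositional.Properties using (∈-resp-↭; ↭-length; ++⁺ʳ; ++-comm; shift; drop-∷)
open import Data.List.Relation.Binary.Subset.Propositional using (_⊆_)
open import Data.List.Relation.Unary.All as All using (All; []; _∷_)
import Data.List.Relation.Unary.All.Properties as All
open import Data.List.Relation.Unary.AllPairs as AllPairs using (AllPairs; []; _∷_)
import Data.List.Relation.Unary.AllPairs.Properties as AllPairs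
open import Data.List.Relation.Unary.Any as Any using (Any; here; there)
open import Data.List.Relation.Unary.Linked.Properties using (Linked⇒AllPairs; AllPairs⇒Linked)
open import Data.List.Relation.Unary.Unique.DecPropositional.Properties using (deduplicate-!)
open import Data.List.Relation.Unary.Unique.Propositional using (Unique)
open import Data.Nat using (ℕ; zero; suc; _+_; _*_; _∸_; _≤_; _≥_; _<_; z≤n; s≤s; z<s; s<s; _≟_; _≤?_; _<?_)
open import Data.Nat.Induction using (Acc; acc; <-wellFounded)
open import Data.Nat.ListAction using (sum)
open import Data.Nat.ListAction.Properties using (sum-++)
open import Data.Nat.Properties
open import Data.Product using (∃-syntax; _×_; _,_; proj₁; proj₂)
open import Data.Sum using (_⊎_; inj₁; inj₂; swap)
open import Data.Unit using (⊤; tt)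
open import Function using (_∘_; flip)
open import Function.Bundles using (_⇔_; mk⇔; module Equivalence)
open import Level using (0ℓ)
open import Relation.Binary using (Rel; Reflexive; Transitive; tri<; tri≈; tri>)
open import Relation.Binary.PropositionalEquality using (_≡_; _≢_; refl; sym; trans; cong; cong₂; subst; subst₂; module ≡-Reasoning)
open import Relation.Nullary using (¬_; Dec; yes; no; contradiction)
open import Relation.Nullary.Decidable using (_×-dec_; _⊎-dec_; _→-dec_; toWitness)
open import Relation.Unary using (Pred; Decidable)
open import Defs

-- Counting finite families

HasCardinality-transfer :
  {A B : Set} {P : Pred A 0ℓ} {Q : Pred B 0ℓ} {n : ℕ} (f : A → B) →
  (∀ {x} → P x → Q (f x)) →
  (∀ {x y} → P x → P y → f x ≡ f y → x ≡ y) →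
  (∀ {y} → Q y → ∃[ x ] P x × f x ≡ y) →
  HasCardinality P n → HasCardinality Q n
HasCardinality-transfer {P = P} {Q} f P⇒Q inj surj (xs , xs! , xs⇔P , refl) =
  map f xs , map! xs xs! (All.tabulate (Equivalence.to (xs⇔P _))) ,
  (λ y → mk⇔ (to y) (from y)) , length-map f xs
  where
  map! : ∀ xs → Unique xs → All P xs → Unique (map f xs)
  map! []       []          []         = []
  map! (x ∷ xs) (x∉ ∷ xs!) (px ∷ pxs) =
    All.map⁺ (All.zipWith (λ (x≢y , py) → x≢y ∘ inj px py) (x∉ , pxs)) ∷ map! xs xs! pxs
  to : ∀ y → y ∈ map f xs → Q y
  to y y∈ with ∈-map⁻ f y∈
  ... | x , x∈ , refl = P⇒Q (Equivalence.to (xs⇔P x) x∈)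
  from : ∀ y → Q y → y ∈ map f xs
  from y q with surj q
  ... | x , px , refl = ∈-map⁺ f (Equivalence.from (xs⇔P x) px)

Unique-⊆⇒length-≤ : {A : Set} {xs ys : List A} → Unique xs → xs ⊆ ys → length xs ≤ length ys
Unique-⊆⇒length-≤ []          _     = z≤n
Unique-⊆⇒length-≤ {xs = x ∷ xs} (x∉xs ∷ xs!) xs⊆ys with ∈-∃++ (xs⊆ys (here refl))
... | us , vs , refl = subst (suc (length xs) ≤_) (sym (length-++-sucʳ us x vs))
  (s≤s (Unique-⊆⇒length-≤ xs! without))
  where
  without : xs ⊆ us ++ vs
  without y∈ with ∈-++⁻ us (xs⊆ys (there y∈))
  ... | inj₁ y∈us         = ∈-++⁺ˡ y∈us
  ... | inj₂ (here refl)  = contradiction refl (All.lookup x∉xs y∈)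
  ... | inj₂ (there y∈vs) = ∈-++⁺ʳ us y∈vs

-- Compositions

-- The second elementary symmetric function of the parts: each part is multiplied
-- by the sum of the later ones.
e₂ : List ℕ → ℕ
e₂ []      = 0
e₂ (m ∷ c) = m * sum c + e₂ c

-- A composition is the list of its parts, which are positive.
IsComposition : Pred (List ℕ) 0ℓ
IsComposition = All (1 ≤_)

-- The compositions that index both families: those with at least two parts, and (1),
-- which accounts for the permutation 1 and the empty partition.
Admissible : Pred (List ℕ) 0ℓ
Admissible c = c ≡ 1 ∷ [] ⊎ 2 ≤ length c

CompositionWith : ℕ → Pred (List ℕ) 0ℓ
CompositionWith k c = IsComposition c × Admissible c × e₂ c ≡ k

compositionWith? : ∀ k → Decidable (CompositionWith k)
compositionWith? k c =
  All.all? (1 ≤?_) c ×-dec ((≡-dec _≟_ c (1 ∷ []) ⊎-dec (2 ≤? length c)) ×-dec (e₂ c ≟ k))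

sum-positive : ∀ {m c} → IsComposition (m ∷ c) → 1 ≤ sum (m ∷ c)
sum-positive (1≤m ∷ _) = ≤-trans 1≤m (m≤m+n _ _)

-- The product of the first part and the sum of the others is at least their sum
-- minus one, as both factors are positive.
sum≤1+e₂ : ∀ {c} → IsComposition c → Admissible c → sum c ≤ suc (e₂ c)
sum≤1+e₂ _ (inj₁ refl) = ≤-refl
sum≤1+e₂ {_ ∷ []} _ (inj₂ (s≤s ()))
sum≤1+e₂ {zero ∷ _ ∷ _} (() ∷ _) (inj₂ _)
sum≤1+e₂ {_ ∷ zero ∷ _} (_ ∷ () ∷ _) (inj₂ _)
sum≤1+e₂ {suc m ∷ suc n ∷ c} _ (inj₂ _) = begin
  suc m + (suc n + sum c)                    ≡⟨ +-comm (suc m) s ⟩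
  s + suc m                                  ≡⟨ +-suc s m ⟩
  suc (s + m)                                ≤⟨ s≤s (+-monoʳ-≤ s (m≤m*n m s)) ⟩
  suc (s + m * s)                            ≤⟨ s≤s (m≤m+n (suc m * s) _) ⟩
  suc (suc m * s + e₂ (suc n ∷ c))           ∎
  where
  open ≤-Reasoning
  s : ℕ
  s = suc n + sum c

parts≤sum : ∀ c → All (_≤ sum c) c
parts≤sum []      = []
parts≤sum (m ∷ c) = m≤m+n m _ ∷ All.map (λ x≤s → ≤-trans x≤s (m≤n+m _ m)) (parts≤sum c)

length≤sum : ∀ {c} → IsComposition c → length c ≤ sum c
length≤sum []         = z≤n
length≤sum (1≤m ∷ cp) = +-mono-≤ 1≤m (length≤sum cp)

-- All lists of length at most l with entries below n.
boundedLists : ℕ → ℕ → List (List ℕ)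
boundedLists n zero    = [] ∷ []
boundedLists n (suc l) = [] ∷ cartesianProductWith _∷_ (upTo n) (boundedLists n l)

∈-boundedLists : ∀ {n} l {c} → length c ≤ l → All (_< n) c → c ∈ boundedLists n l
∈-boundedLists zero    {[]}    _       _          = here refl
∈-boundedLists (suc l) {[]}    _       _          = here refl
∈-boundedLists (suc l) {m ∷ c} (s≤s p) (m<n ∷ c<n) =
  there (∈-cartesianProductWith⁺ _∷_ (∈-upTo⁺ m<n) (∈-boundedLists l p c<n))

-- The sum, hence the length and every part, is at most k + 1. The list of candidates
-- is deduplicated, which spares a proof that it has no repetitions.
CompositionWith-finite : ∀ k → ∃[ n ] HasCardinality (CompositionWith k) n
CompositionWith-finite k = _ , xs , deduplicate-! (≡-dec _≟_) ys , (λ c → mk⇔ (to c) (from c)) , refl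
  where
  ys xs : List (List ℕ)
  ys = filter (compositionWith? k) (boundedLists (suc (suc k)) (suc k))
  xs = deduplicate (≡-dec _≟_) ys
  to : ∀ c → c ∈ xs → CompositionWith k c
  to c c∈ = proj₂ (∈-filter⁻ (compositionWith? k) {xs = boundedLists (suc (suc k)) (suc k)} (∈-deduplicate⁻ (≡-dec _≟_) ys c∈))
  from : ∀ c → CompositionWith k c → c ∈ xs
  from c p@(cp , adm , refl) = ∈-deduplicate⁺ (≡-dec _≟_) (∈-filter⁺ (compositionWith? k)
    (∈-boundedLists (suc k) (≤-trans (length≤sum cp) bound)
      (All.map (λ x≤s → s≤s (≤-trans x≤s bound)) (parts≤sum c))) p)
    where
    bound : sum c ≤ suc (e₂ c)
    bound = sum≤1+e₂ cp adm

-- Runs of consecutive integers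

-- The word b + 1, …, b + m.
run : ℕ → ℕ → Word
run b zero    = []
run b (suc m) = suc b ∷ run (suc b) m

length-run : ∀ b m → length (run b m) ≡ m
length-run b zero    = refl
length-run b (suc m) = cong suc (length-run (suc b) m)

run-lower : ∀ b m → All (b <_) (run b m)
run-lower b zero    = []
run-lower b (suc m) = ≤-refl ∷ All.map (≤-trans (n≤1+n _)) (run-lower (suc b) m)

run-upper : ∀ b m → All (_≤ b + m) (run b m)
run-upper b zero    = []
run-upper b (suc m) rewrite +-suc b m = s≤s (m≤m+n b m) ∷ run-upper (suc b) m

run-+ : ∀ b m n → run b (m + n) ≡ run b m ++ run (b + m) n
run-+ b zero    n rewrite +-identityʳ b = refl
run-+ b (suc m) n rewrite +-suc b m = cong (suc b ∷_) (run-+ (suc b) m n)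

map-suc-run : ∀ b m → map suc (run b m) ≡ run (suc b) m
map-suc-run b zero    = refl
map-suc-run b (suc m) = cong (suc (suc b) ∷_) (map-suc-run (suc b) m)

applyUpTo-run : ∀ {f} b m → (∀ i → f i ≡ suc (b + i)) → applyUpTo f m ≡ run b m
applyUpTo-run b zero    f≗ = refl
applyUpTo-run b (suc m) f≗ = cong₂ _∷_
  (trans (f≗ 0) (cong suc (+-identityʳ b)))
  (applyUpTo-run (suc b) m (λ i → trans (f≗ (suc i)) (cong suc (+-suc b i))))

IsPermutation⇒run : ∀ {π} → IsPermutation π → π ↭ run 0 (length π)
IsPermutation⇒run {π} p = ↭-trans p (↭-reflexive (applyUpTo-run 0 (length π) (λ _ → refl)))

run⇒IsPermutation : ∀ {π} n → π ↭ run 0 n → IsPermutation π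
run⇒IsPermutation {π} n p = subst (λ l → π ↭ applyUpTo suc l) (sym length≡n)
  (↭-trans p (↭-reflexive (sym (applyUpTo-run 0 n (λ _ → refl)))))
  where
  length≡n : length π ≡ n
  length≡n = trans (↭-length p) (length-run 0 n)

-- Skew sums of increasing runs

-- The skew sum of increasing permutations whose lengths are the given parts.
skew : List ℕ → Word
skew []      = []
skew (m ∷ c) = run (sum c) m ++ skew c

length-skew : ∀ c → length (skew c) ≡ sum c
length-skew []      = refl
length-skew (m ∷ c) =
  trans (length-++ (run (sum c) m)) (cong₂ _+_ (length-run (sum c) m) (length-skew c))

skew-upper : ∀ c → All (_≤ sum c) (skew c)
skew-upper []      = []
skew-upper (m ∷ c) = All.++⁺
  (subst (λ s → All (_≤ s) (run (sum c) m)) (+-comm (sum c) m) (run-upper (sum c) m))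
  (All.map (λ x≤s → ≤-trans x≤s (m≤n+m _ m)) (skew-upper c))

skew-↭-run : ∀ c → skew c ↭ run 0 (sum c)
skew-↭-run []      = ↭-refl
skew-↭-run (m ∷ c) = ↭-trans (++-comm (run (sum c) m) (skew c))
  (↭-trans (++⁺ʳ (run (sum c) m) (skew-↭-run c))
    (↭-reflexive (trans (sym (run-+ 0 (sum c) m)) (cong (run 0) (+-comm (sum c) m)))))

skew-IsPermutation : ∀ c → IsPermutation (skew c)
skew-IsPermutation c = run⇒IsPermutation (sum c) (skew-↭-run c)

-- The first letter of a skew sum determines the sum of the parts after the first,
-- and the length then determines the first part.
skew-injective : ∀ {c d} → IsComposition c → IsComposition d → skew c ≡ skew d → c ≡ d
skew-injective {[]}        {[]}        _ _ _ = refl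
skew-injective {[]}        {suc _ ∷ _} _ _ ()
skew-injective {[]}        {zero ∷ _}  _ (() ∷ _) _
skew-injective {suc _ ∷ _} {[]}        _ _ ()
skew-injective {zero ∷ _}  {_}         (() ∷ _) _ _
skew-injective {suc _ ∷ _} {zero ∷ _}  _ (() ∷ _) _
skew-injective {suc m ∷ c} {suc n ∷ d} (_ ∷ cp) (_ ∷ dp) eq = cong₂ _∷_ m≡n c≡d
  where
  s≡t : sum c ≡ sum d
  s≡t = suc-injective (proj₁ (∷-injective eq))
  m≡n : suc m ≡ suc n
  m≡n = +-cancelʳ-≡ (sum c) (suc m) (suc n) (trans (sym (length-skew (suc m ∷ c)))
    (trans (cong length eq) (trans (length-skew (suc n ∷ d)) (cong (suc n +_) (sym s≡t)))))
  c≡d : c ≡ d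
  c≡d = skew-injective cp dp (++-cancelˡ (run (sum c) (suc m)) (skew c) (skew d)
    (trans eq (cong₂ (λ s l → run s l ++ skew d) (sym s≡t) (sym m≡n))))

-- Inversions

-- The number of inversions, by recursion on the word: those whose earlier entry is
-- the first letter, and those of the remaining word.
inv : Word → ℕ
inv []      = 0
inv (x ∷ w) = length (filter (_<? x) w) + inv w

length-filter-map :
  {A B : Set} {P : Pred B 0ℓ} (P? : Decidable P) (f : A → B) (xs : List A) →
  length (filter P? (map f xs)) ≡ length (filter (P? ∘ f) xs)
length-filter-map P? f []       = refl
length-filter-map P? f (x ∷ xs) with P? (f x)
... | yes _ = cong suc (length-filter-map P? f xs)
... | no  _ = length-filter-map P? f xs

length-filter-cartesianProduct :
  {A B : Set} {P : Pred (A × B) 0ℓ} (P? : Decidable P) (xs : List A) (ys : List B) →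
  length (filter P? (cartesianProduct xs ys)) ≡
  sum (map (λ x → length (filter (λ y → P? (x , y)) ys)) xs)
length-filter-cartesianProduct P? []       ys = refl
length-filter-cartesianProduct P? (x ∷ xs) ys =
  trans (cong length (filter-++ P? (map (x ,_) ys) (cartesianProduct xs ys)))
    (trans (length-++ (filter P? (map (x ,_) ys)))
      (cong₂ _+_ (length-filter-map P? (x ,_) ys) (length-filter-cartesianProduct P? xs ys)))

inversion? : ∀ w (i j : Fin (length w)) → Dec (i Fin.< j × lookup w j < lookup w i)
inversion? w i j = (i Fin.<? j) ×-dec (lookup w j <? lookup w i)

-- The number of inversions whose earlier position is i.
inversionsFrom : ∀ w → Fin (length w) → ℕ
inversionsFrom w i = length (filter (inversion? w i) (allFin (length w)))

allFin-suc : ∀ n → allFin (suc n) ≡ zero ∷ map suc (allFin n)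
allFin-suc n = cong (zero ∷_) (sym (map-tabulate (λ i → i) suc))

inversionsFrom-zero : ∀ x w → inversionsFrom (x ∷ w) zero ≡ length (filter (_<? x) w)
inversionsFrom-zero x w = begin
  length (filter (inversion? (x ∷ w) zero) (allFin (suc n)))
    ≡⟨ cong (λ is → length (filter (inversion? (x ∷ w) zero) is)) (allFin-suc n) ⟩
  length (filter (inversion? (x ∷ w) zero) (zero ∷ map suc (allFin n)))
    ≡⟨⟩
  length (filter (inversion? (x ∷ w) zero) (map suc (allFin n)))
    ≡⟨ length-filter-map (inversion? (x ∷ w) zero) suc (allFin n) ⟩
  length (filter (inversion? (x ∷ w) zero ∘ suc) (allFin n))
    ≡⟨ cong length (filter-≐ (inversion? (x ∷ w) zero ∘ suc) ((_<? x) ∘ lookup w) (proj₂ , (z<s ,_)) (allFin n)) ⟩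
  length (filter ((_<? x) ∘ lookup w) (allFin n))
    ≡⟨ length-filter-map (_<? x) (lookup w) (allFin n) ⟨
  length (filter (_<? x) (map (lookup w) (allFin n)))
    ≡⟨ cong (length ∘ filter (_<? x)) (trans (map-tabulate (λ i → i) (lookup w)) (tabulate-lookup w)) ⟩
  length (filter (_<? x) w) ∎
  where
  open ≡-Reasoning
  n : ℕ
  n = length w

inversionsFrom-suc : ∀ x w i → inversionsFrom (x ∷ w) (suc i) ≡ inversionsFrom w i
inversionsFrom-suc x w i = begin
  length (filter (inversion? (x ∷ w) (suc i)) (allFin (suc n)))
    ≡⟨ cong (λ is → length (filter (inversion? (x ∷ w) (suc i)) is)) (allFin-suc n) ⟩
  length (filter (inversion? (x ∷ w) (suc i)) (zero ∷ map suc (allFin n)))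
    ≡⟨⟩
  length (filter (inversion? (x ∷ w) (suc i)) (map suc (allFin n)))
    ≡⟨ length-filter-map (inversion? (x ∷ w) (suc i)) suc (allFin n) ⟩
  length (filter (inversion? (x ∷ w) (suc i) ∘ suc) (allFin n))
    ≡⟨ cong length (filter-≐ (inversion? (x ∷ w) (suc i) ∘ suc) (inversion? w i)
         ((λ { (s<s p , q) → p , q }) , (λ { (p , q) → s<s p , q })) (allFin n)) ⟩
  length (filter (inversion? w i) (allFin n)) ∎
  where
  open ≡-Reasoning
  n : ℕ
  n = length w

length-inversions-sum : ∀ w → length (inversions w) ≡ sum (map (inversionsFrom w) (allFin (length w)))
length-inversions-sum w = length-filter-cartesianProduct _ (allFin (length w)) (allFin (length w))

length-inversions : ∀ w → length (inversions w) ≡ inv w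
length-inversions []      = refl
length-inversions (x ∷ w) = begin
  length (inversions (x ∷ w))
    ≡⟨ length-inversions-sum (x ∷ w) ⟩
  inversionsFrom (x ∷ w) zero + sum (map (inversionsFrom (x ∷ w)) (tabulate suc))
    ≡⟨ cong₂ _+_ (inversionsFrom-zero x w) (cong sum tail) ⟩
  length (filter (_<? x) w) + sum (map (inversionsFrom w) (allFin (length w)))
    ≡⟨ cong (length (filter (_<? x) w) +_) (trans (sym (length-inversions-sum w)) (length-inversions w)) ⟩
  inv (x ∷ w) ∎
  where
  open ≡-Reasoning
  tail : map (inversionsFrom (x ∷ w)) (tabulate suc) ≡ map (inversionsFrom w) (allFin (length w))
  tail = trans (map-tabulate suc (inversionsFrom (x ∷ w)))
    (trans (tabulate-cong (inversionsFrom-suc x w)) (sym (map-tabulate (λ i → i) (inversionsFrom w))))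

-- Each letter of the run is inverted with each letter of w, and with no other.
inv-run-++ : ∀ b m {w} → All (_≤ b) w → inv (run b m ++ w) ≡ m * length w + inv w
inv-run-++ b zero    _           = refl
inv-run-++ b (suc m) {w} w≤b = begin
  length (filter (_<? suc b) (run (suc b) m ++ w)) + inv (run (suc b) m ++ w)
    ≡⟨ cong₂ _+_ (cong length (filter-++ (_<? suc b) (run (suc b) m) w)) (inv-run-++ (suc b) m (All.map m≤n⇒m≤1+n w≤b)) ⟩
  length (filter (_<? suc b) (run (suc b) m) ++ filter (_<? suc b) w) + (m * length w + inv w)
    ≡⟨ cong₂ (λ u v → length (u ++ v) + (m * length w + inv w))
         (filter-none (_<? suc b) (All.map <-asym (run-lower (suc b) m)))
         (filter-all (_<? suc b) (All.map s≤s w≤b)) ⟩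
  length w + (m * length w + inv w)
    ≡⟨ +-assoc (length w) (m * length w) (inv w) ⟨
  suc m * length w + inv w ∎
  where open ≡-Reasoning

inv-skew : ∀ c → inv (skew c) ≡ e₂ c
inv-skew []      = refl
inv-skew (m ∷ c) = trans (inv-run-++ (sum c) m (skew-upper c))
  (cong₂ (λ l k → m * l + k) (length-skew c) (inv-skew c))

-- Pattern avoidance

-- The condition T holds of the values at any three increasing positions.
AllTriples : (ℕ → ℕ → ℕ → Set) → Word → Set
AllTriples T []      = ⊤
AllTriples T (x ∷ w) = AllPairs (T x) w × AllTriples T w

-- Three values, in this order, form neither 132 nor 213.
Allowed : ℕ → ℕ → ℕ → Set
Allowed x y z = ¬ (x < z × z < y) × ¬ (y < x × x < z)

AllPairs-lookup : {A : Set} {R : Rel A 0ℓ} {xs : List A} → AllPairs R xs →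
  ∀ {i j} → i Fin.< j → R (lookup xs i) (lookup xs j)
AllPairs-lookup (px ∷ _)  {zero}  {suc j} _         = All.lookup px (∈-lookup j)
AllPairs-lookup (_ ∷ pxs) {suc i} {suc j} (s<s i<j) = AllPairs-lookup pxs i<j

AllTriples-lookup : ∀ {T} w → AllTriples T w → ∀ {i j k} → i Fin.< j → j Fin.< k →
  T (lookup w i) (lookup w j) (lookup w k)
AllTriples-lookup (x ∷ w) (px , _)  {zero}  {suc j} {suc k} _         (s<s j<k) = AllPairs-lookup px j<k
AllTriples-lookup (x ∷ w) (_ , pw)  {suc i} {suc j} {suc k} (s<s i<j) (s<s j<k) = AllTriples-lookup w pw i<j j<k

lookup-AllPairs : {A : Set} {R : Rel A 0ℓ} (xs : List A) →
  (∀ {i j} → i Fin.< j → R (lookup xs i) (lookup xs j)) → AllPairs R xs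
lookup-AllPairs {R = R} xs r = subst (AllPairs R) (tabulate-lookup xs) (AllPairs.tabulate⁺-< r)

lookup-AllTriples : ∀ {T} w →
  (∀ {i j k} → i Fin.< j → j Fin.< k → T (lookup w i) (lookup w j) (lookup w k)) → AllTriples T w
lookup-AllTriples []      t = tt
lookup-AllTriples (x ∷ w) t =
  lookup-AllPairs w (λ i<j → t z<s (s<s i<j)) ,
  lookup-AllTriples w (λ i<j j<k → t (s<s i<j) (s<s j<k))

-- An order-preserving correspondence between two families of numbers also reflects
-- the order when the source family v has distinct values.
order-iso : {m : ℕ} {u v : Fin m → ℕ} →
  (∀ a b → v a ≡ v b → a ≡ b) → (∀ a b → v a < v b → u a < u b) →
  ∀ a b → u a < u b ⇔ v a < v b
order-iso {u = u} {v} inj mono a b = mk⇔ reflect (mono a b)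
  where
  reflect : u a < u b → v a < v b
  reflect ua<ub with <-cmp (v a) (v b)
  ... | tri< va<vb _ _ = va<vb
  ... | tri≈ _ va≡vb _ = contradiction (cong u (inj a b va≡vb)) (<⇒≢ ua<ub)
  ... | tri> _ _ vb<va = contradiction (mono b a vb<va) (<-asym ua<ub)

-- A map from three positions, given by its values.
triple : {n : ℕ} → Fin n → Fin n → Fin n → Fin 3 → Fin n
triple i j k 0F = i
triple i j k 1F = j
triple i j k 2F = k

triple-mono : {n : ℕ} {i j k : Fin n} → i Fin.< j → j Fin.< k →
  ∀ a b → a Fin.< b → triple i j k a Fin.< triple i j k b
triple-mono i<j j<k 0F 1F _ = i<j
triple-mono {i = i} {j} {k} i<j j<k 0F 2F _ = Fin.<-trans {i = i} {j} {k} i<j j<k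
triple-mono i<j j<k 1F 2F _ = j<k
triple-mono i<j j<k 0F 0F ()
triple-mono i<j j<k 1F 0F ()
triple-mono i<j j<k 1F 1F (s<s ())
triple-mono i<j j<k 2F 0F ()
triple-mono i<j j<k 2F 1F (s<s ())
triple-mono i<j j<k 2F 2F (s<s (s<s ()))

132-pattern 213-pattern : Word
132-pattern = 1 ∷ 3 ∷ 2 ∷ []
213-pattern = 2 ∷ 1 ∷ 3 ∷ []

-- The letters of the word are pairwise distinct.
Distinct : Word → Set
Distinct τ = ∀ a b → lookup τ a ≡ lookup τ b → a ≡ b

distinct? : ∀ τ → Dec (Distinct τ)
distinct? τ = Fin.all? λ a → Fin.all? λ b → (lookup τ a ≟ lookup τ b) →-dec (a Fin.≟ b)

contains-132 : ∀ {w i j k} → i Fin.< j → j Fin.< k →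
  lookup w i < lookup w k → lookup w k < lookup w j → Contains w 132-pattern
contains-132 {w} {i} {j} {k} i<j j<k x<z z<y =
  triple i j k , triple-mono i<j j<k ,
  order-iso (toWitness {a? = distinct? 132-pattern} tt) mono
  where
  mono : ∀ a b → lookup 132-pattern a < lookup 132-pattern b →
    lookup w (triple i j k a) < lookup w (triple i j k b)
  mono 0F 1F _ = <-trans x<z z<y
  mono 0F 2F _ = x<z
  mono 2F 1F _ = z<y
  mono 0F 0F (s<s ())
  mono 1F 0F (s<s ())
  mono 1F 1F (s<s (s<s (s<s ())))
  mono 1F 2F (s<s (s<s ()))
  mono 2F 0F (s<s ())
  mono 2F 2F (s<s (s<s ()))

contains-213 : ∀ {w i j k} → i Fin.< j → j Fin.< k →
  lookup w j < lookup w i → lookup w i < lookup w k → Contains w 213-pattern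
contains-213 {w} {i} {j} {k} i<j j<k y<x x<z =
  triple i j k , triple-mono i<j j<k ,
  order-iso (toWitness {a? = distinct? 213-pattern} tt) mono
  where
  mono : ∀ a b → lookup 213-pattern a < lookup 213-pattern b →
    lookup w (triple i j k a) < lookup w (triple i j k b)
  mono 0F 2F _ = x<z
  mono 1F 0F _ = y<x
  mono 1F 2F _ = <-trans y<x x<z
  mono 0F 0F (s<s (s<s ()))
  mono 0F 1F (s<s ())
  mono 1F 1F (s<s ())
  mono 2F 0F (s<s (s<s ()))
  mono 2F 1F (s<s ())
  mono 2F 2F (s<s (s<s (s<s ())))

Avoids⇒Allowed : ∀ {w} → Avoids w 132-pattern → Avoids w 213-pattern → AllTriples Allowed w
Avoids⇒Allowed {w} a b = lookup-AllTriples w (λ i<j j<k →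
  (λ (x<z , z<y) → a (contains-132 {w} i<j j<k x<z z<y)) ,
  (λ (y<x , x<z) → b (contains-213 {w} i<j j<k y<x x<z)))

Allowed⇒Avoids-132 : ∀ {w} → AllTriples Allowed w → Avoids w 132-pattern
Allowed⇒Avoids-132 {w} t (ι , mono , iso) =
  proj₁ (AllTriples-lookup w t (mono 0F 1F z<s) (mono 1F 2F (s<s z<s)))
    (Equivalence.from (iso 0F 2F) (s<s z<s) , Equivalence.from (iso 2F 1F) (s<s (s<s z<s)))

Allowed⇒Avoids-213 : ∀ {w} → AllTriples Allowed w → Avoids w 213-pattern
Allowed⇒Avoids-213 {w} t (ι , mono , iso) =
  proj₂ (AllTriples-lookup w t (mono 0F 1F z<s) (mono 1F 2F (s<s z<s)))
    (Equivalence.from (iso 1F 0F) (s<s z<s) , Equivalence.from (iso 0F 2F) (s<s (s<s z<s)))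

-- With no letter above x, the letter x plays neither the 1 of a 132 nor the 2 of a 213.
small-Allowed : ∀ {x} w → All (_≤ x) w → AllPairs (Allowed x) w
small-Allowed []      []          = []
small-Allowed (y ∷ w) (_ ∷ w≤x) =
  All.map (λ z≤x → (λ (x<z , _) → ≤⇒≯ z≤x x<z) , (λ (_ , x<z) → ≤⇒≯ z≤x x<z)) w≤x ∷ small-Allowed w w≤x

run-++-Allowed-from : ∀ {x} b m {w} → x ≤ b → All (_≤ x) w → AllPairs (Allowed x) (run b m ++ w)
run-++-Allowed-from b zero    _   w≤x = small-Allowed _ w≤x
run-++-Allowed-from b (suc m) x≤b w≤x =
  All.++⁺
    (All.map (λ y<z → (λ (_ , z<y) → <-asym y<z z<y) , (λ (y<x , _) → <-asym y<x (s≤s x≤b))) (run-lower (suc b) m))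
    (All.map (λ z≤x → (λ (x<z , _) → ≤⇒≯ z≤x x<z) , (λ (_ , x<z) → ≤⇒≯ z≤x x<z)) w≤x)
  ∷ run-++-Allowed-from (suc b) m (m≤n⇒m≤1+n x≤b) w≤x

run-++-Allowed : ∀ b m {w} → All (_≤ b) w → AllTriples Allowed w → AllTriples Allowed (run b m ++ w)
run-++-Allowed b zero    _   t = t
run-++-Allowed b (suc m) w≤b t = run-++-Allowed-from (suc b) m ≤-refl w≤1+b , run-++-Allowed (suc b) m w≤1+b t
  where
  w≤1+b : All (_≤ suc b) _
  w≤1+b = All.map m≤n⇒m≤1+n w≤b

skew-Allowed : ∀ c → AllTriples Allowed (skew c)
skew-Allowed []      = tt
skew-Allowed (m ∷ c) = run-++-Allowed (sum c) m (skew-upper c) (skew-Allowed c)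

-- Permutations avoiding 132 and 213

AllTriples-++⁻ʳ : ∀ {T} v {w} → AllTriples T (v ++ w) → AllTriples T w
AllTriples-++⁻ʳ []      t       = t
AllTriples-++⁻ʳ (x ∷ v) (_ , t) = AllTriples-++⁻ʳ v t

-- Behind a first letter p, a letter above p can follow neither a larger letter
-- nor a letter below p. The letters above p, here b + 1, …, b + k, therefore come
-- first, in increasing order.
leading-run : ∀ {p a} b k {w} → a < p → p ≤ b → w ↭ run 0 a ++ run b k → AllPairs (Allowed p) w →
  ∃[ w′ ] w ≡ run b k ++ w′ × w′ ↭ run 0 a
leading-run b zero    {w} a<p p≤b perm _ = w , refl , ↭-trans perm (↭-reflexive (++-identityʳ _))
leading-run {a = a} b (suc k) {[]} a<p p≤b perm _
  with () ← ∈-resp-↭ (↭-sym perm) (∈-++⁺ʳ (run 0 a) (here refl))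
leading-run {p} {a} b (suc k) {x ∷ w} a<p p≤b perm (px ∷ pw) with ∈-++⁻ (run 0 a) (∈-resp-↭ perm (here refl))
... | inj₂ (here refl) =
  let w′ , eq , perm′ = leading-run (suc b) k a<p (m≤n⇒m≤1+n p≤b)
        (drop-∷ (↭-trans perm (shift (suc b) (run 0 a) (run (suc b) k)))) pw
  in  w′ , cong (suc b ∷_) eq , perm′
... | inj₁ x∈ = contradiction (x<p , s≤s p≤b) (proj₂ (All.lookup px 1+b∈w))
  where
  x<p : x < p
  x<p = ≤-<-trans (All.lookup (run-upper 0 a) x∈) a<p
  1+b∈w : suc b ∈ w
  1+b∈w = Any.tail (λ 1+b≡x → <⇒≢ (<-≤-trans x<p (m≤n⇒m≤1+n p≤b)) (sym 1+b≡x))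
    (∈-resp-↭ (↭-sym perm) (∈-++⁺ʳ (run 0 a) (here refl)))
... | inj₂ (there x∈) = contradiction (s≤s p≤b , 1+b<x) (proj₁ (All.lookup px 1+b∈w))
  where
  1+b<x : suc b < x
  1+b<x = All.lookup (run-lower (suc b) k) x∈
  1+b∈w : suc b ∈ w
  1+b∈w = Any.tail (<⇒≢ 1+b<x) (∈-resp-↭ (↭-sym perm) (∈-++⁺ʳ (run 0 a) (here refl)))

-- A first letter p starts the run of all letters from p to n; what follows is a
-- permutation of the letters below p, and the argument repeats.
Allowed⇒skew : ∀ {n w} → Acc _<_ n → w ↭ run 0 n → AllTriples Allowed w →
  ∃[ c ] IsComposition c × skew c ≡ w
Allowed⇒skew {w = []} _ _ _ = [] , [] , refl
Allowed⇒skew {n} {zero ∷ w} _ perm _ with All.lookup (run-lower 0 n) (∈-resp-↭ perm (here refl))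
... | ()
Allowed⇒skew {n} {suc a ∷ w} (acc rec) perm (pw , tw) with leading-run (suc a) k ≤-refl ≤-refl w↭ pw
  where
  a<n : a < n
  a<n = All.lookup (run-upper 0 n) (∈-resp-↭ perm (here refl))
  k : ℕ
  k = n ∸ suc a
  run-split : run 0 n ≡ run 0 a ++ suc a ∷ run (suc a) k
  run-split = trans (cong (run 0) (trans (sym (m+[n∸m]≡n a<n)) (sym (+-suc a k)))) (run-+ 0 a (suc k))
  w↭ : w ↭ run 0 a ++ run (suc a) k
  w↭ = drop-∷ (↭-trans perm (↭-trans (↭-reflexive run-split) (shift (suc a) (run 0 a) (run (suc a) k))))
... | w′ , refl , w′↭ with Allowed⇒skew (rec (All.lookup (run-upper 0 n) (∈-resp-↭ perm (here refl)))) w′↭ (AllTriples-++⁻ʳ (run (suc a) (n ∸ suc a)) tw)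
... | c , cp , refl = suc (n ∸ suc a) ∷ c , z<s ∷ cp , cong (λ s → run s (suc (n ∸ suc a)) ++ skew c) sum≡a
  where
  sum≡a : sum c ≡ a
  sum≡a = trans (sym (length-skew c)) (trans (↭-length w′↭) (length-run 0 a))

-- Indecomposability

-- Two non-empty suffixes of one word share its last letter.
common-letter : {A : Set} (xs : List A) {ys : List A} (us : List A) {vs : List A} →
  xs ++ ys ≡ us ++ vs → ys ≢ [] → vs ≢ [] → ∃[ z ] z ∈ ys × z ∈ vs
common-letter []       us       {[]}     eq ys≢[] vs≢[] = contradiction refl vs≢[]
common-letter []       us       {v ∷ vs} refl _ _ = v , ∈-++⁺ʳ us (here refl) , here refl
common-letter (x ∷ xs) {[]}     _  _ ys≢[] _ = contradiction refl ys≢[]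
common-letter (x ∷ xs) {y ∷ ys} [] refl _ _ = y , here refl , there (∈-++⁺ʳ xs (here refl))
common-letter (x ∷ xs) (u ∷ us) eq ys≢[] vs≢[] = common-letter xs us (∷-injectiveʳ eq) ys≢[] vs≢[]

map-≢[] : {A B : Set} {f : A → B} {xs : List A} → xs ≢ [] → map f xs ≢ []
map-≢[] {xs = []}    xs≢[] _ = xs≢[] refl
map-≢[] {xs = _ ∷ _} _ ()

-- The first letter of a skew sum exceeds every letter of the last summand, while
-- the first letter of a direct sum is smaller than every letter of its last summand.
skew-indecomposable : ∀ {c} → IsComposition c → Admissible c → Indecomposable (skew c)
skew-indecomposable _ (inj₁ refl) = (λ ()) , λ where
  ([] , τ , _ , _ , ρ≢[] , _ , _)         → ρ≢[] refl
  (_ ∷ _ , [] , _ , _ , _ , τ≢[] , _)     → τ≢[] refl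
  (_ ∷ [] , _ ∷ _ , _ , _ , _ , _ , ())
  (_ ∷ _ ∷ _ , _ ∷ _ , _ , _ , _ , _ , ())
skew-indecomposable {_ ∷ []} _ (inj₂ (s≤s ()))
skew-indecomposable {zero ∷ _} (() ∷ _) _
skew-indecomposable {_ ∷ zero ∷ _} (_ ∷ () ∷ _) _
skew-indecomposable {suc m ∷ suc n ∷ c} cp (inj₂ _) = (λ ()) , indec
  where
  d : List ℕ
  d = suc n ∷ c
  indec : ¬ Decomposable (skew (suc m ∷ d))
  indec ([] , τ , _ , _ , ρ≢[] , _ , _) = ρ≢[] refl
  indec (x ∷ ρ , τ , ρ-perm , _ , _ , τ≢[] , eq) = contradiction (begin-strict
      u                ≤⟨ All.lookup (skew-upper d) u∈skew ⟩
      sum d            <⟨ n<1+n (sum d) ⟩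
      suc (sum d)      ≡⟨ proj₁ (∷-injective eq) ⟩
      x                ≤⟨ All.lookup (run-upper 0 l) (∈-resp-↭ (IsPermutation⇒run ρ-perm) (here refl)) ⟩
      l                ≤⟨ m≤m+n l t ⟩
      l + t            ≡⟨ u≡l+t ⟨
      u                ∎) (n≮n u)
    where
    open ≤-Reasoning
    l : ℕ
    l = length (x ∷ ρ)
    common : ∃[ z ] z ∈ skew d × z ∈ map (l +_) τ
    common = common-letter (run (sum d) (suc m)) (x ∷ ρ) eq (λ ()) (map-≢[] τ≢[])
    u : ℕ
    u = proj₁ common
    u∈skew : u ∈ skew d
    u∈skew = proj₁ (proj₂ common)
    shifted : ∃[ t ] t ∈ τ × u ≡ l + t
    shifted = ∈-map⁻ (l +_) (proj₂ (proj₂ common))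
    t : ℕ
    t = proj₁ shifted
    u≡l+t : u ≡ l + t
    u≡l+t = proj₂ (proj₂ shifted)

run-IsPermutation : ∀ n → IsPermutation (run 0 n)
run-IsPermutation n = run⇒IsPermutation n ↭-refl

-- With a single part the skew sum is increasing, hence decomposable beyond length 1.
indecomposable-skew⇒Admissible : ∀ {c} → IsComposition c → Indecomposable (skew c) → Admissible c
indecomposable-skew⇒Admissible {[]} _ (≢[] , _) = contradiction refl ≢[]
indecomposable-skew⇒Admissible {zero ∷ []} (() ∷ _) _
indecomposable-skew⇒Admissible {1 ∷ []} _ _ = inj₁ refl
indecomposable-skew⇒Admissible {suc (suc m) ∷ []} _ (_ , indec) = contradiction
  (run 0 1 , run 0 (suc m) , run-IsPermutation 1 , run-IsPermutation (suc m) , (λ ()) , (λ ()) ,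
    trans (++-identityʳ (run 0 (suc (suc m)))) (cong (1 ∷_) (sym (map-suc-run 0 (suc m)))))
  indec
indecomposable-skew⇒Admissible {_ ∷ _ ∷ _} _ _ = inj₂ (s≤s (s≤s z≤n))

I-HasCardinality : ∀ {k n} → HasCardinality (CompositionWith k) n →
  HasCardinality (I k (132-pattern ∷ 213-pattern ∷ [])) n
I-HasCardinality {k} = HasCardinality-transfer skew sound
  (λ (cp , _) (dp , _) → skew-injective cp dp) complete
  where
  sound : ∀ {c} → CompositionWith k c → I k (132-pattern ∷ 213-pattern ∷ []) (skew c)
  sound {c} (cp , adm , refl) =
    skew-IsPermutation c , skew-indecomposable cp adm ,
    trans (length-inversions (skew c)) (inv-skew c) ,
    Allowed⇒Avoids-132 {skew c} (skew-Allowed c) ∷ Allowed⇒Avoids-213 {skew c} (skew-Allowed c) ∷ []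
  complete : ∀ {π} → I k (132-pattern ∷ 213-pattern ∷ []) π → ∃[ c ] CompositionWith k c × skew c ≡ π
  complete {π} (perm , indec , invs , av132 ∷ av213 ∷ [])
    with Allowed⇒skew (<-wellFounded _) (IsPermutation⇒run perm) (Avoids⇒Allowed {π} av132 av213)
  ... | c , cp , refl = c , (cp , indecomposable-skew⇒Admissible cp indec ,
    trans (sym (trans (length-inversions (skew c)) (inv-skew c))) invs) , refl

-- The partition of a composition

-- A composition m₁, …, mᵣ gives, for each j < r, a block of mⱼ rows, each of
-- length mⱼ₊₁ + ⋯ + mᵣ. The outer corner of that block lies in column
-- mⱼ₊₁ + ⋯ + mᵣ and row m₁ + ⋯ + mⱼ, so all corners lie on one antidiagonal.
shape : List ℕ → List ℕ
shape []          = []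
shape (m ∷ [])    = []
shape (m ∷ n ∷ c) = replicate m (sum (n ∷ c)) ++ shape (n ∷ c)

sum-replicate : ∀ m s → sum (replicate m s) ≡ m * s
sum-replicate zero    s = refl
sum-replicate (suc m) s = cong (s +_) (sum-replicate m s)

sum-shape : ∀ c → sum (shape c) ≡ e₂ c
sum-shape []          = refl
sum-shape (m ∷ [])    = sym (trans (+-identityʳ (m * 0)) (*-zeroʳ m))
sum-shape (m ∷ n ∷ c) = trans (sum-++ (replicate m (sum (n ∷ c))) (shape (n ∷ c)))
  (cong₂ _+_ (sum-replicate m (sum (n ∷ c))) (sum-shape (n ∷ c)))

replicate-all : {P : Pred ℕ 0ℓ} {s : ℕ} (m : ℕ) → P s → All P (replicate m s)
replicate-all zero    p = []
replicate-all (suc m) p = p ∷ replicate-all m p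

shape-< : ∀ {c} → IsComposition c → All (_< sum c) (shape c)
shape-< {[]}        _           = []
shape-< {m ∷ []}    _           = []
shape-< {m ∷ n ∷ c} (1≤m ∷ cp) = All.++⁺
  (replicate-all m (m<n+m (sum (n ∷ c)) 1≤m))
  (All.map (λ x<s → <-≤-trans x<s (m≤n+m _ m)) (shape-< cp))

shape-positive : ∀ {c} → IsComposition c → All (1 ≤_) (shape c)
shape-positive {[]}        _          = []
shape-positive {m ∷ []}    _          = []
shape-positive {m ∷ n ∷ c} (_ ∷ cp) = All.++⁺ (replicate-all m (sum-positive cp)) (shape-positive cp)

replicate-++-↘ : ∀ {s} m {ρ} → All (_≤ s) ρ → AllPairs _≥_ ρ → AllPairs _≥_ (replicate m s ++ ρ)
replicate-++-↘ zero    ρ≤s ρ↘ = ρ↘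
replicate-++-↘ (suc m) ρ≤s ρ↘ = All.++⁺ (replicate-all m ≤-refl) ρ≤s ∷ replicate-++-↘ m ρ≤s ρ↘

shape-↘ : ∀ {c} → IsComposition c → AllPairs _≥_ (shape c)
shape-↘ {[]}        _          = []
shape-↘ {m ∷ []}    _          = []
shape-↘ {m ∷ n ∷ c} (_ ∷ cp) = replicate-++-↘ m (All.map <⇒≤ (shape-< cp)) (shape-↘ cp)

replicate-++-injective : ∀ {s} m n {ρ σ} → All (_< s) ρ → All (_< s) σ →
  replicate m s ++ ρ ≡ replicate n s ++ σ → m ≡ n × ρ ≡ σ
replicate-++-injective zero    zero    _         _         eq = refl , eq
replicate-++-injective zero    (suc n) (x<x ∷ _) _ refl = contradiction x<x (n≮n _)
replicate-++-injective (suc m) zero    _ (x<x ∷ _) refl = contradiction x<x (n≮n _)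
replicate-++-injective (suc m) (suc n) ρ<s σ<s eq =
  let m≡n , ρ≡σ = replicate-++-injective m n ρ<s σ<s (∷-injectiveʳ eq) in cong suc m≡n , ρ≡σ

-- The shape of a one-part composition is empty and forgets the part, but the sum
-- of the remaining parts is known from the preceding row.
shape-injective′ : ∀ {c d} → IsComposition c → IsComposition d →
  sum c ≡ sum d → shape c ≡ shape d → c ≡ d
shape-injective : ∀ {c d} → IsComposition c → IsComposition d → 2 ≤ length c → 2 ≤ length d →
  shape c ≡ shape d → c ≡ d

shape-injective′ {[]}         {[]}         _ _ _ _ = refl
shape-injective′ {[]}         {zero ∷ _}   _ (() ∷ _) _ _
shape-injective′ {zero ∷ _}   {_}          (() ∷ _) _ _ _
shape-injective′ {suc _ ∷ _}  {zero ∷ _}   _ (() ∷ _) _ _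
shape-injective′ {suc m ∷ []} {suc n ∷ []} _ _ sums _ =
  cong (_∷ []) (trans (sym (+-identityʳ (suc m))) (trans sums (+-identityʳ (suc n))))
shape-injective′ {suc _ ∷ []} {suc _ ∷ _ ∷ _} _ _ _ ()
shape-injective′ {suc _ ∷ _ ∷ _} {suc _ ∷ []} _ _ _ ()
shape-injective′ {suc _ ∷ _ ∷ _} {suc _ ∷ _ ∷ _} cp dp _ eq =
  shape-injective cp dp (s≤s (s≤s z≤n)) (s≤s (s≤s z≤n)) eq

shape-injective {_ ∷ []} _ _ (s≤s ()) _ _
shape-injective {_ ∷ _ ∷ _} {_ ∷ []} _ _ _ (s≤s ()) _
shape-injective {zero ∷ _} (() ∷ _) _ _ _ _
shape-injective {suc _ ∷ _ ∷ _} {zero ∷ _} _ (() ∷ _) _ _ _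
shape-injective {suc m ∷ m′ ∷ c} {suc n ∷ n′ ∷ d} (_ ∷ cp) (_ ∷ dp) _ _ eq =
  cong₂ _∷_ (proj₁ blocks) (shape-injective′ cp dp s≡t (proj₂ blocks))
  where
  s≡t : sum (m′ ∷ c) ≡ sum (n′ ∷ d)
  s≡t = proj₁ (∷-injective eq)
  blocks : suc m ≡ suc n × shape (m′ ∷ c) ≡ shape (n′ ∷ d)
  blocks = replicate-++-injective (suc m) (suc n) (shape-< cp)
    (subst (λ s → All (_< s) (shape (n′ ∷ d))) (sym s≡t) (shape-< dp))
    (trans eq (cong (λ s → replicate (suc n) s ++ shape (n′ ∷ d)) (sym s≡t)))

shape-injective-Admissible : ∀ {c d} → IsComposition c → IsComposition d →
  Admissible c → Admissible d → shape c ≡ shape d → c ≡ d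
shape-injective-Admissible _ _ (inj₁ refl) (inj₁ refl) _ = refl
shape-injective-Admissible {d = zero ∷ _} _ (() ∷ _) (inj₁ refl) (inj₂ _) _
shape-injective-Admissible {d = _ ∷ []} _ _ (inj₁ refl) (inj₂ (s≤s ())) _
shape-injective-Admissible {d = suc _ ∷ _ ∷ _} _ _ (inj₁ refl) (inj₂ _) ()
shape-injective-Admissible {zero ∷ _} (() ∷ _) _ (inj₂ _) (inj₁ refl) _
shape-injective-Admissible {_ ∷ []} _ _ (inj₂ (s≤s ())) (inj₁ refl) _
shape-injective-Admissible {suc _ ∷ _ ∷ _} _ _ (inj₂ _) (inj₁ refl) ()
shape-injective-Admissible cp dp (inj₂ 2≤) (inj₂ 2≤′) eq = shape-injective cp dp 2≤ 2≤′ eq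

-- Cells and ranks

Cell : Set
Cell = ℕ × ℕ

-- The antidiagonal on which a cell lies; it increases strictly along chains.
rank : Cell → ℕ
rank (a , i) = a + i

≼-refl : ∀ {x} → x ≼ x
≼-refl = ≤-refl , ≤-refl

≼-trans : ∀ {x y z} → x ≼ y → y ≼ z → x ≼ z
≼-trans (p , q) (p′ , q′) = ≤-trans p p′ , ≤-trans q q′

rank-mono : ∀ {x y} → x ≼ y → rank x ≤ rank y
rank-mono (p , q) = +-mono-≤ p q

≼-rank⇒≡ : ∀ {x y} → x ≼ y → rank y ≤ rank x → x ≡ y
≼-rank⇒≡ {a , i} {b , j} (a≤b , i≤j) b+j≤a+i = cong₂ _,_
  (≤-antisym a≤b (+-cancelʳ-≤ j b a (≤-trans b+j≤a+i (+-monoʳ-≤ a i≤j))))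
  (≤-antisym i≤j (+-cancelˡ-≤ b j i (≤-trans b+j≤a+i (+-monoˡ-≤ i a≤b))))

Comparable : Rel Cell 0ℓ
Comparable x y = x ≼ y ⊎ y ≼ x

comparable-rank⇒≡ : ∀ {x y} → Comparable x y → rank x ≡ rank y → x ≡ y
comparable-rank⇒≡ (inj₁ x≼y) eq = ≼-rank⇒≡ x≼y (≤-reflexive (sym eq))
comparable-rank⇒≡ (inj₂ y≼x) eq = sym (≼-rank⇒≡ y≼x (≤-reflexive eq))

comparable-rank-< : ∀ {x y} → Comparable x y → rank x < rank y → x ≼ y
comparable-rank-< (inj₁ x≼y) _ = x≼y
comparable-rank-< (inj₂ y≼x) x<y = contradiction (rank-mono y≼x) (<⇒≱ x<y)

-- Intervals of cells meet every intermediate antidiagonal.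
interpolate : ∀ {x y} s → x ≼ y → rank x ≤ s → s ≤ rank y →
  ∃[ z ] x ≼ z × z ≼ y × rank z ≡ s
interpolate {a , i} {b , j} s (a≤b , i≤j) a+i≤s s≤b+j with s ≤? i + b
... | yes s≤i+b = (s ∸ i , i) ,
  (m+n≤o⇒m≤o∸n a a+i≤s , ≤-refl) , (m≤n+o⇒m∸n≤o s i s≤i+b , i≤j) , m∸n+n≡m (≤-trans (m≤n+m i a) a+i≤s)
... | no  s≰i+b = (b , s ∸ b) ,
  (a≤b , m+n≤o⇒m≤o∸n i i+b≤s) ,
  (≤-refl , m≤n+o⇒m∸n≤o s b s≤b+j) , m+[n∸m]≡n (≤-trans (m≤n+m b i) i+b≤s)
  where
  i+b≤s : i + b ≤ s
  i+b≤s = <⇒≤ (≰⇒> s≰i+b)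

chain-comparable : ∀ {C} → AllPairs Comparable C → ∀ {x y} → x ∈ C → y ∈ C → Comparable x y
chain-comparable (_  ∷ _)  (here refl) (here refl) = inj₁ ≼-refl
chain-comparable (px ∷ _)  (here refl) (there y∈)  = All.lookup px y∈
chain-comparable (px ∷ _)  (there x∈)  (here refl) = swap (All.lookup px x∈)
chain-comparable (_  ∷ pc) (there x∈)  (there y∈)  = chain-comparable pc x∈ y∈

-- A non-empty finite chain has a least element; applied to the opposite relation,
-- a greatest one.
least : {A : Set} {R : Rel A 0ℓ} → Reflexive R → Transitive R → ∀ {x xs} →
  AllPairs (λ y z → R y z ⊎ R z y) (x ∷ xs) → ∃[ v ] v ∈ x ∷ xs × All (R v) (x ∷ xs)
least r t {x} {[]}     _         = x , here refl , r ∷ []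
least r t {x} {y ∷ ys} (px ∷ ps) with least r t ps
... | v , v∈ , v≤ with All.lookup px v∈
... | inj₁ x≤v = x , here refl , r ∷ All.map (t x≤v) v≤
... | inj₂ v≤x = v , there v∈ , v≤x ∷ v≤

-- Order ideals of partitions

ideal-there : ∀ {ρ d a i} → Ideal ρ (a , i) → Ideal (d ∷ ρ) (a , suc i)
ideal-there (j , refl , 1≤a , a≤) = suc j , refl , 1≤a , a≤

ideal-∷⁻ : ∀ {ρ d a i} → Ideal (d ∷ ρ) (a , i) →
  (i ≡ 1 × 1 ≤ a × a ≤ d) ⊎ ∃[ i′ ] i ≡ suc i′ × Ideal ρ (a , i′)
ideal-∷⁻ (zero  , refl , 1≤a , a≤d) = inj₁ (refl , 1≤a , a≤d)
ideal-∷⁻ (suc j , refl , 1≤a , a≤)  = inj₂ (_ , refl , j , refl , 1≤a , a≤)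

ideal-positive : ∀ ρ {x} → Ideal ρ x → (1 , 1) ≼ x
ideal-positive ρ (j , refl , 1≤a , _) = 1≤a , z<s

-- The row of a cell is at least as long as the column index of the cell.
ideal-column : ∀ {ρ a i} {P : Pred ℕ 0ℓ} → All P ρ → Ideal ρ (a , i) → ∃[ d ] P d × a ≤ d
ideal-column {ρ} pρ (j , refl , _ , a≤) = lookup ρ j , All.lookup pρ (∈-lookup j) , a≤

ideal-down : ∀ {ρ} → AllPairs _≥_ ρ → ∀ {x y} → Ideal ρ y → (1 , 1) ≼ x → x ≼ y → Ideal ρ x
ideal-down {d ∷ ρ} (d≥ ∷ ρ↘) {a , suc zero} {b , j} y∈ (1≤a , _) (a≤b , _) with ideal-∷⁻ y∈
... | inj₁ (_ , _ , b≤d) = zero , refl , 1≤a , ≤-trans a≤b b≤d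
... | inj₂ (_ , _ , y∈ρ) with ideal-column d≥ y∈ρ
... | _ , e≤d , b≤e = zero , refl , 1≤a , ≤-trans a≤b (≤-trans b≤e e≤d)
ideal-down {d ∷ ρ} (d≥ ∷ ρ↘) {a , suc (suc i)} {b , j} y∈ (1≤a , _) (a≤b , i≤j) with ideal-∷⁻ y∈
... | inj₁ (refl , _ , _) with s≤s () ← i≤j
... | inj₂ (j′ , refl , y∈ρ) = ideal-there (ideal-down ρ↘ y∈ρ (1≤a , z<s) (a≤b , ≤-pred i≤j))

-- Pure ideals are Gorenstein

-- Every cell of the ideal lies below one of rank n; in particular n bounds all ranks.
-- For the empty partition this holds for every n.
Pure : List ℕ → ℕ → Set
Pure ρ n = ∀ {x} → Ideal ρ x → ∃[ y ] Ideal ρ y × x ≼ y × rank y ≡ n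

-- Prepending a row shifts the given ideal by one rank. The cells of the new row are
-- below its last one, which either has the right rank itself or lies below a
-- cell of the shifted ideal.
pure-∷ : ∀ {ρ n s} → Pure ρ n → s ≡ n ⊎ Ideal ρ (s , 1) → Pure (s ∷ ρ) (suc n)
pure-∷ {ρ} {n} {s} pure top {a , i} x∈ with ideal-∷⁻ x∈
... | inj₂ (i′ , refl , x∈ρ) with pure x∈ρ
...   | (b , j) , y∈ , (a≤b , i≤j) , refl = (b , suc j) , ideal-there y∈ , (a≤b , s≤s i≤j) , +-suc b j
pure-∷ {s = s} pure (inj₁ refl) x∈ | inj₁ (refl , 1≤a , a≤s) =
  (s , 1) , (zero , refl , ≤-trans 1≤a a≤s , ≤-refl) , (a≤s , ≤-refl) , +-comm s 1
pure-∷ pure (inj₂ s∈) x∈ | inj₁ (refl , 1≤a , a≤s) with pure s∈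
... | (b , j) , y∈ , (s≤b , _) , refl = (b , suc j) , ideal-there y∈ , (≤-trans a≤s s≤b , z<s) , +-suc b j

pure-replicate : ∀ {ρ s} m → 1 ≤ s → Pure ρ s → Pure (replicate m s ++ ρ) (m + s)
pure-replicate zero          1≤s pure = pure
pure-replicate (suc zero)    1≤s pure = pure-∷ pure (inj₁ refl)
pure-replicate (suc (suc m)) 1≤s pure =
  pure-∷ (pure-replicate (suc m) 1≤s pure) (inj₂ (zero , refl , 1≤s , ≤-refl))

pure-shape : ∀ {c} → IsComposition c → Pure (shape c) (sum c)
pure-shape {[]}        _        (() , _)
pure-shape {m ∷ []}    _        (() , _)
pure-shape {m ∷ n ∷ c} (_ ∷ cp) = pure-replicate m (sum-positive cp) (pure-shape cp)

-- A maximal chain meets the antidiagonal of every cell of the ideal. If it missed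
-- one, it could be extended, since some cell on that antidiagonal lies between the
-- part of the chain below and the part above.
maximal-chain-rank : ∀ {ρ n} → AllPairs _≥_ ρ → Pure ρ n → ∀ {D} → IsMaximalChain (Ideal ρ) D →
  ∀ {x} → Ideal ρ x → Any (λ y → rank y ≡ rank x) D
maximal-chain-rank {ρ} {n} ρ↘ pure {D} ((D! , D⊆ρ , D-chain) , maximal) {x} x∈
  with Any.any? (λ y → rank y ≟ rank x) D
... | yes hit = hit
... | no  miss = contradiction (maximal (z ∷ D) z∷D-chain there (here refl)) z∉D
  where
  s : ℕ
  s = rank x

  lows highs : List Cell
  lows  = filter (λ y → rank y <? s) D
  highs = filter (λ y → s <? rank y) D

  bottom∈ρ : Ideal ρ (1 , 1)
  bottom∈ρ = ideal-down ρ↘ x∈ ≼-refl (ideal-positive ρ x∈)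

  2≤s : 2 ≤ s
  2≤s = rank-mono (ideal-positive ρ x∈)

  -- The greatest element of the chain below the antidiagonal, or else (1 , 1).
  lower : ∃[ u ] Ideal ρ u × rank u ≤ s × All (_≼ u) lows × (∀ {y} → y ∈ highs → u ≼ y)
  lower with lows in eq
  ... | [] = (1 , 1) , bottom∈ρ , 2≤s , [] ,
        λ y∈ → ideal-positive ρ (All.lookup D⊆ρ (proj₁ (∈-filter⁻ (λ y → s <? rank y) y∈)))
  ... | l ∷ ls with least {R = flip _≼_} ≼-refl (flip ≼-trans)
                    (AllPairs.map swap (subst (AllPairs Comparable) eq (AllPairs.filter⁺ (λ y → rank y <? s) D-chain)))
  ... | u , u∈ , ≼u with ∈-filter⁻ (λ y → rank y <? s) {xs = D} (subst (u ∈_) (sym eq) u∈)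
  ... | u∈D , u<s = u , All.lookup D⊆ρ u∈D , <⇒≤ u<s , ≼u , below
    where
    below : ∀ {y} → y ∈ highs → u ≼ y
    below y∈ with ∈-filter⁻ (λ y → s <? rank y) {xs = D} y∈
    ... | y∈D , s<y = comparable-rank-< (chain-comparable D-chain u∈D y∈D) (<-trans u<s s<y)

  u : Cell
  u = proj₁ lower
  u∈ρ : Ideal ρ u
  u∈ρ = proj₁ (proj₂ lower)
  u≤s : rank u ≤ s
  u≤s = proj₁ (proj₂ (proj₂ lower))
  lows≼u : All (_≼ u) lows
  lows≼u = proj₁ (proj₂ (proj₂ (proj₂ lower)))
  u≼highs : ∀ {y} → y ∈ highs → u ≼ y
  u≼highs = proj₂ (proj₂ (proj₂ (proj₂ lower)))

  -- The least element of the chain above the antidiagonal, or else a cell of rank n.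
  upper : ∃[ v ] Ideal ρ v × u ≼ v × s ≤ rank v × All (v ≼_) highs
  upper with highs in eq
  ... | [] with pure u∈ρ | pure x∈
  ...   | v , v∈ , u≼v , refl | _ , _ , x≼w , w≡n = v , v∈ , u≼v , subst (s ≤_) w≡n (rank-mono x≼w) , []
  upper | h ∷ hs with least {R = _≼_} ≼-refl ≼-trans
                      (subst (AllPairs Comparable) eq (AllPairs.filter⁺ (λ y → s <? rank y) D-chain))
  ... | v , v∈ , v≼ with ∈-filter⁻ (λ y → s <? rank y) {xs = D} (subst (v ∈_) (sym eq) v∈)
  ... | v∈D , s<v = v , All.lookup D⊆ρ v∈D ,
        u≼highs (subst (v ∈_) (sym eq) v∈) , <⇒≤ s<v , v≼

  v : Cell
  v = proj₁ upper
  v∈ρ : Ideal ρ v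
  v∈ρ = proj₁ (proj₂ upper)
  u≼v : u ≼ v
  u≼v = proj₁ (proj₂ (proj₂ upper))
  s≤v : s ≤ rank v
  s≤v = proj₁ (proj₂ (proj₂ (proj₂ upper)))
  v≼highs : All (v ≼_) highs
  v≼highs = proj₂ (proj₂ (proj₂ (proj₂ upper)))

  between : ∃[ z ] u ≼ z × z ≼ v × rank z ≡ s
  between = interpolate s u≼v u≤s s≤v

  z : Cell
  z = proj₁ between
  u≼z : u ≼ z
  u≼z = proj₁ (proj₂ between)
  z≼v : z ≼ v
  z≼v = proj₁ (proj₂ (proj₂ between))
  rank-z : rank z ≡ s
  rank-z = proj₂ (proj₂ (proj₂ between))

  z∉D : ¬ z ∈ D
  z∉D z∈D = miss (lose z∈D rank-z)

  z-comparable : ∀ {y} → y ∈ D → Comparable z y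
  z-comparable {y} y∈D with <-cmp (rank y) s
  ... | tri< y<s _ _ = inj₂ (≼-trans (All.lookup lows≼u (∈-filter⁺ (λ y → rank y <? s) y∈D y<s)) u≼z)
  ... | tri≈ _ y≡s _ = contradiction (lose y∈D y≡s) miss
  ... | tri> _ _ s<y = inj₁ (≼-trans z≼v (All.lookup v≼highs (∈-filter⁺ (λ y → s <? rank y) y∈D s<y)))

  z∷D-chain : IsChain (Ideal ρ) (z ∷ D)
  z∷D-chain =
    All.tabulate (λ { y∈D refl → z∉D y∈D }) ∷ D! ,
    ideal-down ρ↘ v∈ρ (≼-trans (ideal-positive ρ u∈ρ) u≼z) z≼v ∷ D⊆ρ ,
    All.tabulate z-comparable ∷ D-chain

-- Any two maximal chains have the same set of ranks, and ranks are distinct on a chain.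
pure⇒Gorenstein : ∀ {ρ n} → AllPairs _≥_ ρ → Pure ρ n → Gorenstein ρ
pure⇒Gorenstein {ρ} ρ↘ pure C D C-max D-max = ≤-antisym (le C-max D-max) (le D-max C-max)
  where
  le : ∀ {C D} → IsMaximalChain (Ideal ρ) C → IsMaximalChain (Ideal ρ) D → length C ≤ length D
  le {C} {D} ((C! , C⊆ρ , C-chain) , _) D-max =
    subst₂ _≤_ (length-map rank C) (length-map rank D) (Unique-⊆⇒length-≤ ranks! ranks⊆)
    where
    ranks! : Unique (map rank C)
    ranks! = AllPairs.map⁺ (AllPairs.zipWith
      (λ (x≢y , cmp) → x≢y ∘ comparable-rank⇒≡ cmp) (C! , C-chain))
    ranks⊆ : map rank C ⊆ map rank D
    ranks⊆ r∈ with ∈-map⁻ rank r∈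
    ... | x , x∈C , refl with find (maximal-chain-rank ρ↘ pure D-max (All.lookup C⊆ρ x∈C))
    ... | y , y∈D , y≡x = subst (_∈ map rank D) y≡x (∈-map⁺ rank y∈D)

-- Gorenstein partitions are shapes

-- A maximal cell of the ideal, that is, an outer corner of the partition.
IsCorner : List ℕ → Pred Cell 0ℓ
IsCorner ρ x = Ideal ρ x × (∀ {y} → Ideal ρ y → x ≼ y → x ≡ y)

-- A saturated chain, listed downwards, from the cell (a + 1 , i + 1) to (1 , 1).
path : ℕ → ℕ → List Cell
path zero    zero    = (1 , 1) ∷ []
path zero    (suc a) = (suc (suc a) , 1) ∷ path zero a
path (suc i) a       = (suc a , suc (suc i)) ∷ path i a

length-path : ∀ i a → length (path i a) ≡ suc (a + i)
length-path zero    zero    = refl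
length-path zero    (suc a) = cong suc (length-path zero a)
length-path (suc i) a       = cong suc (trans (length-path i a) (sym (+-suc a i)))

path-≼ : ∀ i a → All (_≼ (suc a , suc i)) (path i a)
path-≼ zero    zero    = ≼-refl ∷ []
path-≼ zero    (suc a) = ≼-refl ∷ All.map (λ p → ≼-trans p (n≤1+n _ , ≤-refl)) (path-≼ zero a)
path-≼ (suc i) a       = ≼-refl ∷ All.map (λ p → ≼-trans p (≤-refl , n≤1+n _)) (path-≼ i a)

path-positive : ∀ i a → All ((1 , 1) ≼_) (path i a)
path-positive zero    zero    = ≼-refl ∷ []
path-positive zero    (suc a) = (z<s , z<s) ∷ path-positive zero a
path-positive (suc i) a       = (z<s , z<s) ∷ path-positive i a

path-top : ∀ i a → (suc a , suc i) ∈ path i a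
path-top zero    zero    = here refl
path-top zero    (suc a) = here refl
path-top (suc i) a       = here refl

path-descends : ∀ i a → AllPairs (λ x y → y ≼ x × rank y < rank x) (path i a)
path-descends zero    zero    = [] ∷ []
path-descends zero    (suc a) =
  All.map (λ p → ≼-trans p (n≤1+n _ , ≤-refl) , s≤s (rank-mono p)) (path-≼ zero a) ∷ path-descends zero a
path-descends (suc i) a       =
  All.map (λ p → ≼-trans p (≤-refl , n≤1+n _) ,
    ≤-<-trans (rank-mono p) (+-monoʳ-< (suc a) (n<1+n (suc i)))) (path-≼ i a) ∷ path-descends i a

path-rank : ∀ i a {s} → 2 ≤ s → s ≤ suc a + suc i → Any (λ y → rank y ≡ s) (path i a)
path-rank zero    zero    2≤s s≤ = here (≤-antisym 2≤s s≤)
path-rank zero    (suc a) 2≤s s≤ with m≤n⇒m<n∨m≡n s≤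
... | inj₁ s<   = there (path-rank zero a 2≤s (≤-pred s<))
... | inj₂ refl = here refl
path-rank (suc i) a {s} 2≤s s≤ with m≤n⇒m<n∨m≡n s≤
... | inj₁ s<   = there (path-rank i a 2≤s (≤-pred (subst (suc s ≤_) (+-suc (suc a) (suc i)) s<)))
... | inj₂ refl = here refl

-- A cell comparable with the corner lies below it, and the saturated chain already
-- contains a cell of its rank.
path-maximal : ∀ {ρ} → AllPairs _≥_ ρ → ∀ {a i} → IsCorner ρ (suc a , suc i) →
  IsMaximalChain (Ideal ρ) (path i a)
path-maximal {ρ} ρ↘ {a} {i} (x∈ , top) =
  ( AllPairs.map (λ { (_ , y<x) refl → n≮n _ y<x }) (path-descends i a)
  , All.zipWith (λ (pos , y≼x) → ideal-down ρ↘ x∈ pos y≼x) (path-positive i a , path-≼ i a)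
  , AllPairs.map (inj₂ ∘ proj₁) (path-descends i a) ) ,
  maximal
  where
  maximal : ∀ D → IsChain (Ideal ρ) D → path i a ⊆ D → D ⊆ path i a
  maximal D (_ , D⊆ρ , D-chain) C⊆D {y} y∈D with chain-comparable D-chain (C⊆D (path-top i a)) y∈D
  ... | inj₁ x≼y = subst (_∈ path i a) (top (All.lookup D⊆ρ y∈D) x≼y) (path-top i a)
  ... | inj₂ y≼x with find (path-rank i a (rank-mono (ideal-positive ρ (All.lookup D⊆ρ y∈D))) (rank-mono y≼x))
  ... | z , z∈ , z≡y = subst (_∈ path i a)
        (comparable-rank⇒≡ (chain-comparable D-chain (C⊆D z∈) y∈D) z≡y) z∈

-- All corners lie on one antidiagonal.
Aligned : List ℕ → Set
Aligned ρ = ∀ {x y} → IsCorner ρ x → IsCorner ρ y → rank x ≡ rank y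

Gorenstein⇒Aligned : ∀ {ρ} → AllPairs _≥_ ρ → Gorenstein ρ → Aligned ρ
Gorenstein⇒Aligned {ρ} ρ↘ gor {zero , _} (x∈ , _) _ with () ← proj₁ (ideal-positive ρ x∈)
Gorenstein⇒Aligned {ρ} ρ↘ gor {suc _ , zero} (x∈ , _) _ with () ← proj₂ (ideal-positive ρ x∈)
Gorenstein⇒Aligned {ρ} ρ↘ gor {suc _ , suc _} {zero , _} _ (y∈ , _) with () ← proj₁ (ideal-positive ρ y∈)
Gorenstein⇒Aligned {ρ} ρ↘ gor {suc _ , suc _} {suc _ , zero} _ (y∈ , _) with () ← proj₂ (ideal-positive ρ y∈)
Gorenstein⇒Aligned {ρ} ρ↘ gor {suc a , suc i} {suc b , suc j} x-corner y-corner = begin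
  suc a + suc i          ≡⟨ +-suc (suc a) i ⟩
  suc (suc (a + i))      ≡⟨ cong suc (length-path i a) ⟨
  suc (length (path i a)) ≡⟨ cong suc (gor _ _ (path-maximal ρ↘ x-corner) (path-maximal ρ↘ y-corner)) ⟩
  suc (length (path j b)) ≡⟨ cong suc (length-path j b) ⟩
  suc (suc (b + j))      ≡⟨ +-suc (suc b) j ⟨
  suc b + suc j          ∎
  where open ≡-Reasoning

corner-there : ∀ {ρ d a i} → IsCorner ρ (a , i) → IsCorner (d ∷ ρ) (a , suc i)
corner-there {ρ} {d} {a} {i} (x∈ , top) = ideal-there x∈ , top′
  where
  top′ : ∀ {y} → Ideal (d ∷ ρ) y → (a , suc i) ≼ y → (a , suc i) ≡ y
  top′ y∈ (a≤b , i≤j) with ideal-∷⁻ y∈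
  ... | inj₂ (j′ , refl , y∈ρ) with refl ← top y∈ρ (a≤b , ≤-pred i≤j) = refl
  ... | inj₁ (refl , _ , _) with () ← ≤-trans (proj₂ (ideal-positive ρ x∈)) (≤-pred i≤j)

corner-here : ∀ {ρ d} → 1 ≤ d → All (_< d) ρ → IsCorner (d ∷ ρ) (d , 1)
corner-here {ρ} {d} 1≤d ρ<d = (zero , refl , 1≤d , ≤-refl) , top
  where
  top : ∀ {y} → Ideal (d ∷ ρ) y → (d , 1) ≼ y → (d , 1) ≡ y
  top y∈ (d≤b , _) with ideal-∷⁻ y∈
  ... | inj₁ (refl , _ , b≤d) = cong (_, 1) (≤-antisym d≤b b≤d)
  ... | inj₂ (_ , _ , y∈ρ) with ideal-column ρ<d y∈ρ
  ... | _ , e<d , b≤e = contradiction (≤-trans d≤b b≤e) (<⇒≱ e<d)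

aligned-∷⁻ : ∀ {d ρ} → Aligned (d ∷ ρ) → Aligned ρ
aligned-∷⁻ aligned {a , i} {b , j} x y =
  suc-injective (trans (sym (+-suc a i)) (trans (aligned (corner-there x) (corner-there y)) (+-suc b j)))

pure⇒corner : ∀ {ρ n x} → Pure ρ n → Ideal ρ x → ∃[ y ] IsCorner ρ y × rank y ≡ n
pure⇒corner {ρ} pure x∈ with pure x∈
... | y , y∈ , _ , refl = y , (y∈ , top) , refl
  where
  top : ∀ {z} → Ideal ρ z → y ≼ z → y ≡ z
  top {z} z∈ y≼z with pure z∈
  ... | _ , _ , z≼w , w≡n = ≼-rank⇒≡ y≼z (subst (rank z ≤_) w≡n (rank-mono z≼w))

-- The rows are removed one at a time. A row as long as the next one enlarges the
-- first part; a longer row has its own corner, so its length is the rank of the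
-- corners below it, and it contributes a new first part 1.
aligned⇒shape : ∀ ρ → AllPairs _≥_ ρ → All (1 ≤_) ρ → Aligned ρ →
  ∃[ c ] IsComposition c × Admissible c × shape c ≡ ρ
aligned⇒shape [] _ _ _ = 1 ∷ [] , ≤-refl ∷ [] , inj₁ refl , refl
aligned⇒shape (d ∷ []) _ (1≤d ∷ _) _ =
  1 ∷ d ∷ [] , ≤-refl ∷ 1≤d ∷ [] , inj₂ ≤-refl , cong (_∷ []) (+-identityʳ d)
aligned⇒shape (d ∷ h ∷ t) ((h≤d ∷ _) ∷ ρ↘@(t≤h ∷ _)) (1≤d ∷ 1≤ρ@(1≤h ∷ _)) aligned
  with aligned⇒shape (h ∷ t) ρ↘ 1≤ρ (aligned-∷⁻ aligned)
... | _ , _ , inj₁ refl , ()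
... | _ ∷ [] , _ , inj₂ _ , ()
... | zero ∷ _ ∷ _ , () ∷ _ , _ , _
... | c@(suc m ∷ n ∷ c′) , cp , inj₂ _ , eq with m≤n⇒m<n∨m≡n h≤d
...   | inj₂ refl = suc (suc m) ∷ n ∷ c′ , z<s ∷ All.tail cp , inj₂ (s≤s (s≤s z≤n)) ,
        cong₂ _∷_ (proj₁ (∷-injective eq)) eq
...   | inj₁ h<d = 1 ∷ c , ≤-refl ∷ cp , inj₂ (s≤s (s≤s z≤n)) , cong₂ _∷_ (sym d≡sum) eq
  where
  corner : ∃[ y ] IsCorner (h ∷ t) y × rank y ≡ sum c
  corner = pure⇒corner (subst (λ ρ → Pure ρ (sum c)) eq (pure-shape cp)) (zero , refl , 1≤h , ≤-refl)
  d≡sum : d ≡ sum c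
  d≡sum with corner
  ... | (b , j) , y-corner , rank≡ = suc-injective (begin
    suc d           ≡⟨ +-comm d 1 ⟨
    d + 1           ≡⟨ aligned (corner-here 1≤d (h<d ∷ All.map (λ e≤h → ≤-<-trans e≤h h<d) t≤h)) (corner-there y-corner) ⟩
    b + suc j       ≡⟨ +-suc b j ⟩
    suc (b + j)     ≡⟨ cong suc rank≡ ⟩
    suc (sum c)     ∎)
    where open ≡-Reasoning

GorensteinPartition-HasCardinality : ∀ {k n} → HasCardinality (CompositionWith k) n →
  HasCardinality (GorensteinPartition k) n
GorensteinPartition-HasCardinality {k} = HasCardinality-transfer shape sound
  (λ (cp , cadm , _) (dp , dadm , _) → shape-injective-Admissible cp dp cadm dadm) complete
  where
  sound : ∀ {c} → CompositionWith k c → GorensteinPartition k (shape c)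
  sound {c} (cp , _ , refl) =
    (AllPairs⇒Linked (shape-↘ cp) , shape-positive cp , sum-shape c) ,
    pure⇒Gorenstein (shape-↘ cp) (pure-shape cp)
  complete : ∀ {ρ} → GorensteinPartition k ρ → ∃[ c ] CompositionWith k c × shape c ≡ ρ
  complete {ρ} ((ρ-linked , 1≤ρ , sum≡k) , gor)
    with aligned⇒shape ρ ρ↘ 1≤ρ (Gorenstein⇒Aligned ρ↘ gor)
    where
    ρ↘ : AllPairs _≥_ ρ
    ρ↘ = Linked⇒AllPairs (λ p q → ≤-trans q p) ρ-linked
  ... | c , cp , adm , refl = c , (cp , adm , trans (sym (sum-shape c)) sum≡k) , refl

theorem15 : (k : ℕ) →
    ∃[ n ] (HasCardinality (I k ((1 ∷ 3 ∷ 2 ∷ []) ∷ (2 ∷ 1 ∷ 3 ∷ []) ∷ [])) n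
    × HasCardinality (GorensteinPartition k) n)
theorem15 k =
  let n , compositions = CompositionWith-finite k
  in  n , I-HasCardinality compositions , GorensteinPartition-HasCardinality compositions
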